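{- Let $k\ge 1$. The cycle of gaps $\mathcal{G}(p_{k+1})$ is obtained from the cycle of gaps $\mathcal{G}(p_k)=(g_{k,1},\ldots,g_{k,\Phi_k})$ by the following three steps. (R1) The next prime is $p_{k+1}=g_{k,1}+1$. (R2) Concatenate $p_{k+1}$ copies of $\mathcal{G}(p_k)$, giving the sequence $g_{k,1},g_{k,2},\ldots,g_{k,p_{k+1}\Phi_k}$ (indices of $g_{k,\cdot}$ extended periodically with period $\Phi_k$). (R3) In this concatenated sequence, add together $g_{k,1}+g_{k,2}$ and record the index of this addition as $\tilde{i}_1=1$; then for $n=1,\ldots,\Phi_k-1$ successively, add together $g_{k,j}+g_{k,j+1}$ and set $\tilde{i}_{n+1}=j$, where $j$ is the index with $$\Gamma_{k,j}-\Gamma_{k,\tilde{i}_n}=p_{k+1}\cdot g_{k,n}.$$ The sequence resulting from performing all of these additions is $\mathcal{G}(p_{k+1})$.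
   Context: $p_i$ denotes the $i$-th prime ($p_1=2$), $\Pi_k=\prod_{i=1}^k p_i$, and $\Phi_k=\prod_{i=1}^k(p_i-1)$. The cycle of gaps $\mathcal{G}(p_k)=(g_{k,1},\ldots,g_{k,\Phi_k})$ is the sequence of differences between consecutive integers in $[1,\Pi_k+1]$ that are coprime to $\Pi_k$, listed in increasing order starting from $1$. (For example $\mathcal{G}(3)=(4,2)$ and $\mathcal{G}(5)=(6,4,2,4,2,4,6,2)$.) The indexing is extended periodically, $g_{k,j+\Phi_k}=g_{k,j}$, and $\Gamma_{k,j}=\sum_{i=1}^{j} g_{k,i}$, so the integers greater than $1$ coprime to $\Pi_k$ are exactly $1+\Gamma_{k,j}$, $j\ge 1$. "Adding together $g_{k,j}+g_{k,j+1}$" means replacing these two adjacent gaps by their sum, i.e. deleting the integer $1+\Gamma_{k,j}$ that separates them from the underlying list of integers. -}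

module Defs where

open import Data.Bool.Base using (if_then_else_)
open import Data.Empty using (⊥-elim)
open import Data.List.Base
  using (List; []; _∷_; applyUpTo; filter; foldl; length; lookup; map; zip)
open import Data.List.Membership.Propositional using (_∈_)
open import Data.List.Membership.Propositional.Properties
  using (∈-applyUpTo⁺; ∈-filter⁺)
open import Data.List.Relation.Unary.All using (_∷_)
open import Data.List.Relation.Unary.Any using (here; there)
open import Data.Nat.Base
open import Data.Nat.Coprimality using (Coprime; coprime?; 1-coprimeTo; coprime-+)
open import Data.Nat.DivMod using (_mod_)
open import Data.Nat.Divisibility
  using (∣-trans; ∣1⇒≡1; ∣m+n∣m⇒∣n; m∣m*n; m≤n⇒m!∣n!)
open import Data.Nat.ListAction using (product; sum)
open import Data.Nat.Primality
  using (Prime; prime?; ¬prime[1]; prime⇒nonZero)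
open import Data.Nat.Primality.Factorisation using (factorise; PrimeFactorisation)
open import Data.Nat.Properties
open import Data.Product.Base using (_×_; _,_; ∃-syntax; proj₁; proj₂)
open import Data.Sum.Base using (inj₁; inj₂)
open import Relation.Binary.PropositionalEquality
  using (_≡_; _≢_; refl; sym; trans; cong; subst)
open import Relation.Nullary using (yes; no; does)

-- Primes

IsLeastPrimeFrom : ℕ → ℕ → Set
IsLeastPrimeFrom m q = m ≤ q × Prime q × (∀ r → m ≤ r → Prime r → q ≤ r)

private
  leastPrimeFrom : ∀ m d → Prime (m + d) → ∃[ q ] IsLeastPrimeFrom m q
  leastPrimeFrom m d pr with prime? m
  ... | yes pm = m , ≤-refl , pm , λ _ m≤r _ → m≤r
  leastPrimeFrom m zero pr | no ¬pm =
    ⊥-elim (¬pm (subst Prime (+-identityʳ m) pr))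
  leastPrimeFrom m (suc d) pr | no ¬pm
    with leastPrimeFrom (suc m) d (subst Prime (+-suc m d) pr)
  ... | q , m<q , pq , least = q , <⇒≤ m<q , pq , least′
    where
    least′ : ∀ r → m ≤ r → Prime r → q ≤ r
    least′ r m≤r rp =
      least r (≤∧≢⇒< m≤r λ m≡r → ¬pm (subst Prime (sym m≡r) rp)) rp

  n∣n! : ∀ n .{{_ : NonZero n}} → ∃[ c ] n ! ≡ n * c
  n∣n! (suc n) = n ! , refl

  primeAbove : ∀ n → ∃[ q ] (n < q × Prime q)
  primeAbove n with factorise (suc (n !))
  ... | record { factors = [] ; isFactorisation = eq } =
    ⊥-elim (n≢0 (suc-injective eq))
    where
    n≢0 : n ! ≢ 0
    n≢0 = ≢-nonZero⁻¹ (n !) {{n !≢0}}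
  ... | record { factors = q ∷ qs ; isFactorisation = eq ; factorsPrime = pq ∷ _ }
    with ≤-<-connex q n
  ... | inj₂ n<q = q , n<q , pq
  ... | inj₁ q≤n = ⊥-elim (¬prime[1] (subst Prime (∣1⇒≡1 q∣1) pq))
    where
    open import Data.Nat.Divisibility using (_∣_)
    instance _ = prime⇒nonZero pq
    q∣n! : q ∣ n !
    q∣n! = ∣-trans (subst (q ∣_) (sym (proj₂ (n∣n! q))) (m∣m*n _)) (m≤n⇒m!∣n! q≤n)
    q∣1 : q ∣ 1
    q∣1 = ∣m+n∣m⇒∣n
      (subst (q ∣_) (trans (sym eq) (+-comm 1 (n !))) (m∣m*n (product qs))) q∣n!

-- Opaque because its type determines q, while unfolding the search makes
-- type checking of terms mentioning p extremely slow.
opaque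
  nextPrime-spec : ∀ n → ∃[ q ] IsLeastPrimeFrom (suc n) q
  nextPrime-spec n with primeAbove n
  ... | q , n<q , pq =
    leastPrimeFrom (suc n) (q ∸ suc n) (subst Prime (sym (m+[n∸m]≡n n<q)) pq)

nextPrime : ℕ → ℕ
nextPrime n = proj₁ (nextPrime-spec n)

-- The i-th prime for i ≥ 1; the value at 0 only starts the recursion.
p : ℕ → ℕ
p zero    = 1
p (suc i) = nextPrime (p i)

Π : ℕ → ℕ
Π k = product (applyUpTo (λ i → p (suc i)) k)

Φ : ℕ → ℕ
Φ k = product (applyUpTo (λ i → p (suc i) ∸ 1) k)

-- The cycle of gaps

coprimes : ℕ → List ℕ
coprimes k = filter (λ m → coprime? m (Π k)) (applyUpTo suc (Π k + 1))

-- Applied only to increasing lists, on which _∸_ is genuine subtraction.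
differences : List ℕ → List ℕ
differences (a ∷ b ∷ xs) = (b ∸ a) ∷ differences (b ∷ xs)
differences _            = []

𝒢 : ℕ → List ℕ
𝒢 k = differences (coprimes k)

private
  Π≢0 : ∀ k → NonZero (Π k)
  Π≢0 k = go (λ i → p (suc i)) k λ i →
    prime⇒nonZero (proj₁ (proj₂ (proj₂ (nextPrime-spec (p i)))))
    where
    go : ∀ (f : ℕ → ℕ) n → (∀ i → NonZero (f i)) → NonZero (product (applyUpTo f n))
    go f zero    nz = _
    go f (suc n) nz =
      m*n≢0 (f 0) _ {{nz 0}} {{go (λ i → f (suc i)) n (λ i → nz (suc i))}}

  differences-nonempty : ∀ {a b} xs → a ∈ xs → b ∈ xs → a ≢ b →
                         NonZero (length (differences xs))
  differences-nonempty (x ∷ [])    (here refl) (here refl) a≢b = ⊥-elim (a≢b refl)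
  differences-nonempty (x ∷ y ∷ _) _           _           _   = _

length-𝒢-nonZero : ∀ k → NonZero (length (𝒢 k))
length-𝒢-nonZero k = differences-nonempty (coprimes k)
  (∈-filter⁺ (λ m → coprime? m (Π k))
    (∈-applyUpTo⁺ suc (m≤n+m 1 (Π k))) (1-coprimeTo (Π k)))
  (∈-filter⁺ (λ m → coprime? m (Π k))
    (∈-applyUpTo⁺ suc (subst (Π k <_) (+-comm 1 (Π k)) ≤-refl))
    (subst (λ m → Coprime m (Π k)) (+-comm (Π k) 1) (coprime-+ (1-coprimeTo (Π k)))))
  (λ 1≡1+Π → ≢-nonZero⁻¹ (Π k) {{Π≢0 k}} (sym (suc-injective 1≡1+Π)))

-- The periodic extension g_{k,j}, indexed from j = 1; g k 0 is never used.
g : ℕ → ℕ → ℕ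
g k j = lookup (𝒢 k) (((j ∸ 1) mod length (𝒢 k)) {{length-𝒢-nonZero k}})

Γ : ℕ → ℕ → ℕ
Γ k j = sum (applyUpTo (λ i → g k (suc i)) j)

-- Adding adjacent gaps together

-- A block (j , s) is a sum s of adjacent gaps of the original sequence, the
-- last of which has original index j. Indices thus keep referring to the
-- original sequence however many additions have been made.
Block : Set
Block = ℕ × ℕ

blocks : List ℕ → List Block
blocks xs = zip (applyUpTo suc (length xs)) xs

-- Merges the block ending with original gap j with the block after it, which
-- begins with original gap j + 1: this deletes the integer separating them.
-- When gaps j and j + 1 are not in adjacent separate blocks, nothing changes.
addTogether : ℕ → List Block → List Block
addTogether j ((i , s) ∷ (i′ , s′) ∷ bs) =
  if does (i ≟ j)
  then (i′ , s + s′) ∷ bs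
  else (i , s) ∷ addTogether j ((i′ , s′) ∷ bs)
addTogether j bs = bs

performAdditions : List ℕ → List ℕ → List ℕ
performAdditions js xs =
  map proj₂ (foldl (λ bs j → addTogether j bs) (blocks xs) js)

-- Γ_{k,j} − Γ_{k,i} = p_{k+1} · g_{k,n}, without subtraction on ℕ.
Spaced : (k n i j : ℕ) → Set
Spaced k n i j = Γ k j ≡ Γ k i + p (suc k) * g k n

-- ĩ 1, …, ĩ (Φ k) are the recorded indices; other values of ĩ are irrelevant.
-- The bound on ĩ n says that gaps ĩ n and ĩ n + 1 both lie in the
-- concatenated sequence.
record IsAdditionIndices (k : ℕ) (ĩ : ℕ → ℕ) : Set where
  field
    first   : ĩ 1 ≡ 1
    next    : ∀ n → 1 ≤ n → n < Φ k → Spaced k n (ĩ n) (ĩ (suc n))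
    unique  : ∀ n → 1 ≤ n → n < Φ k → ∀ j → Spaced k n (ĩ n) j → j ≡ ĩ (suc n)
    inRange : ∀ n → 1 ≤ n → n ≤ Φ k → 1 ≤ ĩ n × ĩ n < p (suc k) * Φ k

{-# OPTIONS --safe #-}
-- The numbers u j = 1 + Γ j enumerate, in increasing order, the positive
-- integers coprime to Π k. The integers coprime to Π (suc k) are obtained from
-- these by deleting the multiples of q = p (suc k), which are exactly the
-- products q * u i; the recursion in (R3) computes the indices of these
-- products, because q * u (n + 1) − q * u n = q * g (n + 1). One period of the
-- new cycle is q old periods, in which q * u i lies precisely when i < Φ k.
-- Counting what is left after the deletions gives the length Φ of the cycle.
module Submission where

open import Defs
open import Data.Bool.Base using (if_then_else_)
open import Data.Fin.Base using (zero; suc; toℕ)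
open import Data.Fin.Properties using (toℕ-fromℕ<; toℕ-injective; toℕ<n)
open import Data.List.Base
  using (List; []; _∷_; _++_; applyUpTo; concat; filter; foldl; length; lookup; map; replicate; zip)
open import Data.List.Membership.Propositional using (_∈_; _∉_; lose)
open import Data.List.Membership.Propositional.Properties
  using (∈-applyUpTo⁺; ∈-applyUpTo⁻; ∈-filter⁺; ∈-filter⁻; ∈-map⁺; ∈-map⁻; ∈-lookup)
open import Data.List.Properties
  using (∷-injectiveˡ; ∷-injectiveʳ; applyUpTo-∷ʳ; filter-accept; filter-all; filter-reject;
         length-applyUpTo; length-map)
open import Data.List.Relation.Unary.All as All using (All; []; _∷_)
import Data.List.Relation.Unary.All.Properties as All
open import Data.List.Relation.Unary.AllPairs as AllPairs using (AllPairs; []; _∷_)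
import Data.List.Relation.Unary.AllPairs.Properties as AllPairs
open import Data.List.Relation.Unary.Any using (Any; here; there)
open import Data.Nat.Base
open import Data.Nat.Coprimality as Coprimality
  using (Coprime; coprime?; coprime-+; coprime-divisor; 1-coprimeTo; prime⇒coprime)
open import Data.Nat.DivMod
  using (_mod_; _%_; _/_; m≡m%n+[m/n]*n; m%n<n; [m+n]%n≡m%n; m<n⇒m%n≡m)
open import Data.Nat.Divisibility
open import Data.Nat.ListAction using (product; sum)
open import Data.Nat.ListAction.Properties using (product-++; sum-++)
open import Data.Nat.Primality
  using (Prime; prime⇒irreducible; prime⇒nonTrivial; prime⇒nonZero; ¬prime[1])
open import Data.Nat.Primality.Factorisation using (factorise)
open import Data.Nat.Properties
open import Data.Product.Base using (_×_; _,_; ∃-syntax; proj₁; proj₂)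
open import Data.Sum.Base using (inj₁; inj₂)
open import Function.Base using (_∘_; id)
open import Relation.Binary.PropositionalEquality
  using (_≡_; _≢_; refl; sym; trans; cong; cong₂; subst; subst₂; module ≡-Reasoning)
open import Relation.Nullary using (Dec; yes; no; does; ¬_; ¬?; contradiction)
open import Relation.Nullary.Decidable using (dec-true; dec-false)

-- Lists of natural numbers

applyUpTo-cong : ∀ {A : Set} {f h : ℕ → A} n → (∀ i → f i ≡ h i) →
                 applyUpTo f n ≡ applyUpTo h n
applyUpTo-cong zero    f≗h = refl
applyUpTo-cong (suc n) f≗h = cong₂ _∷_ (f≗h 0) (applyUpTo-cong n (f≗h ∘ suc))

applyUpTo-+ : ∀ {A : Set} (f : ℕ → A) m n →
              applyUpTo f (m + n) ≡ applyUpTo f m ++ applyUpTo (λ i → f (m + i)) n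
applyUpTo-+ f zero    n = refl
applyUpTo-+ f (suc m) n = cong (f 0 ∷_) (applyUpTo-+ (f ∘ suc) m n)

applyUpTo-lookup : ∀ {A : Set} (xs : List A) f → (∀ i → f (toℕ i) ≡ lookup xs i) →
                   applyUpTo f (length xs) ≡ xs
applyUpTo-lookup []       f f≗ = refl
applyUpTo-lookup (x ∷ xs) f f≗ =
  cong₂ _∷_ (f≗ zero) (applyUpTo-lookup xs (f ∘ suc) (f≗ ∘ suc))

concat-replicate-periodic : ∀ {A : Set} (f : ℕ → A) ℓ q → (∀ i → f (ℓ + i) ≡ f i) →
  concat (replicate q (applyUpTo f ℓ)) ≡ applyUpTo f (q * ℓ)
concat-replicate-periodic f ℓ zero    periodic = refl
concat-replicate-periodic f ℓ (suc q) periodic = begin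
  applyUpTo f ℓ ++ concat (replicate q (applyUpTo f ℓ))
    ≡⟨ cong (applyUpTo f ℓ ++_) (concat-replicate-periodic f ℓ q periodic) ⟩
  applyUpTo f ℓ ++ applyUpTo f (q * ℓ)
    ≡⟨ cong (applyUpTo f ℓ ++_) (applyUpTo-cong (q * ℓ) periodic) ⟨
  applyUpTo f ℓ ++ applyUpTo (λ i → f (ℓ + i)) (q * ℓ)
    ≡⟨ applyUpTo-+ f ℓ (q * ℓ) ⟨
  applyUpTo f (ℓ + q * ℓ) ∎
  where open ≡-Reasoning

sum-applyUpTo-suc : ∀ f n → sum (applyUpTo f (suc n)) ≡ sum (applyUpTo f n) + f n
sum-applyUpTo-suc f n = begin
  sum (applyUpTo f (suc n))              ≡⟨ cong sum (applyUpTo-∷ʳ f n) ⟨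
  sum (applyUpTo f n ++ f n ∷ [])        ≡⟨ sum-++ (applyUpTo f n) _ ⟩
  sum (applyUpTo f n) + (f n + 0)        ≡⟨ cong (sum (applyUpTo f n) +_) (+-identityʳ (f n)) ⟩
  sum (applyUpTo f n) + f n              ∎
  where open ≡-Reasoning

product-applyUpTo-suc : ∀ f n → product (applyUpTo f (suc n)) ≡ product (applyUpTo f n) * f n
product-applyUpTo-suc f n = begin
  product (applyUpTo f (suc n))          ≡⟨ cong product (applyUpTo-∷ʳ f n) ⟨
  product (applyUpTo f n ++ f n ∷ [])    ≡⟨ product-++ (applyUpTo f n) _ ⟩
  product (applyUpTo f n) * (f n * 1)    ≡⟨ cong (product (applyUpTo f n) *_) (*-identityʳ (f n)) ⟩
  product (applyUpTo f n) * f n          ∎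
  where open ≡-Reasoning

-- Increasing lists, their differences, and deletion of entries.

Increasing : List ℕ → Set
Increasing = AllPairs _<_

tail-⊆ : ∀ {x y xs ys} → x ≡ y → All (x <_) xs →
         (∀ {z} → z ∈ x ∷ xs → z ∈ y ∷ ys) → ∀ {z} → z ∈ xs → z ∈ ys
tail-⊆ refl x<xs sub z∈xs with sub (there z∈xs)
... | here refl  = contradiction refl (<⇒≢ (All.lookup x<xs z∈xs))
... | there z∈ys = z∈ys

-- Each head is the least member of the common set, so the heads agree, and strictness keeps them
-- out of the tails. This lets two lists be identified by comparing membership alone.
increasing-ext : ∀ {xs ys} → Increasing xs → Increasing ys →
                 (∀ {z} → z ∈ xs → z ∈ ys) → (∀ {z} → z ∈ ys → z ∈ xs) → xs ≡ ys
increasing-ext []      []      _   _   = refl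
increasing-ext []      (_ ∷ _) _   sup with () ← sup (here refl)
increasing-ext (_ ∷ _) []      sub _   with () ← sub (here refl)
increasing-ext {x ∷ xs} {y ∷ ys} (x<xs ∷ xs↗) (y<ys ∷ ys↗) sub sup =
  cong₂ _∷_ x≡y (increasing-ext xs↗ ys↗ (tail-⊆ x≡y x<xs sub) (tail-⊆ (sym x≡y) y<ys sup))
  where
  least : ∀ {a z zs} → All (z <_) zs → a ∈ z ∷ zs → z ≤ a
  least _    (here refl)  = ≤-refl
  least z<zs (there a∈zs) = <⇒≤ (All.lookup z<zs a∈zs)
  x≡y : x ≡ y
  x≡y = ≤-antisym (least x<xs (sup (here refl))) (least y<ys (sub (here refl)))

differences-positive : ∀ {xs} → Increasing xs → All (0 <_) (differences xs)
differences-positive []                         = []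
differences-positive (_ ∷ [])                   = []
differences-positive ((a<b ∷ _) ∷ xs↗@(_ ∷ _)) = m<n⇒0<n∸m a<b ∷ differences-positive xs↗

-- Telescoping: absorbing the first difference into `a` gives the next entry `b`, from which the
-- recursion continues. Monotonicity makes each truncated subtraction exact.
partialSums-differences : ∀ {a xs} f n → Increasing (a ∷ xs) →
  applyUpTo f n ≡ differences (a ∷ xs) →
  applyUpTo (λ j → a + sum (applyUpTo f j)) (suc n) ≡ a ∷ xs
partialSums-differences {a} {[]}     f zero    _ _ = cong (_∷ []) (+-identityʳ a)
partialSums-differences {a} {b ∷ ys} f (suc n) ((a<b ∷ _) ∷ ys↗) eq =
  cong₂ _∷_ (+-identityʳ a)
    (trans (applyUpTo-cong (suc n) shift)
           (partialSums-differences (f ∘ suc) n ys↗ (∷-injectiveʳ eq)))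
  where
  shift : ∀ j → a + (f 0 + sum (applyUpTo (f ∘ suc) j)) ≡ b + sum (applyUpTo (f ∘ suc) j)
  shift j = begin
    a + (f 0 + sum (applyUpTo (f ∘ suc) j)) ≡⟨ +-assoc a (f 0) _ ⟨
    a + f 0 + sum (applyUpTo (f ∘ suc) j)
      ≡⟨ cong (λ d → a + d + sum (applyUpTo (f ∘ suc) j)) (∷-injectiveˡ eq) ⟩
    a + (b ∸ a) + sum (applyUpTo (f ∘ suc) j)
      ≡⟨ cong (_+ sum (applyUpTo (f ∘ suc) j)) (m+[n∸m]≡n (<⇒≤ a<b)) ⟩
    b + sum (applyUpTo (f ∘ suc) j) ∎
    where open ≡-Reasoning

length-differences : ∀ a xs → length (differences (a ∷ xs)) ≡ length xs
length-differences a []       = refl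
length-differences a (b ∷ xs) = cong suc (length-differences b xs)

-- Written as a left fold, one index at a time, to run in step with the fold in `performAdditions`.
delete : List ℕ → List ℕ → List ℕ
delete js bs = foldl (λ bs j → filter (λ b → ¬? (b ≟ j)) bs) bs js

∈-delete⁺ : ∀ {x} js {bs} → x ∈ bs → x ∉ js → x ∈ delete js bs
∈-delete⁺ []       x∈bs x∉js = x∈bs
∈-delete⁺ (j ∷ js) x∈bs x∉js =
  ∈-delete⁺ js (∈-filter⁺ (λ b → ¬? (b ≟ j)) x∈bs (x∉js ∘ here)) (x∉js ∘ there)

∈-delete⁻ : ∀ {x} js {bs} → x ∈ delete js bs → x ∈ bs × x ∉ js
∈-delete⁻ []       x∈ = x∈ , λ ()
∈-delete⁻ (j ∷ js) x∈ =
  let x∈′ , x∉js  = ∈-delete⁻ js x∈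
      x∈bs , x≢j = ∈-filter⁻ (λ b → ¬? (b ≟ j)) x∈′
  in x∈bs , λ { (here x≡j) → x≢j x≡j ; (there x∈js) → x∉js x∈js }

delete-increasing : ∀ js {bs} → Increasing bs → Increasing (delete js bs)
delete-increasing []       bs↗ = bs↗
delete-increasing (j ∷ js) bs↗ =
  delete-increasing js (AllPairs.filter⁺ (λ b → ¬? (b ≟ j)) bs↗)

filter-≢-∉ : ∀ {j bs} → All (j <_) bs → filter (λ b → ¬? (b ≟ j)) bs ≡ bs
filter-≢-∉ j<bs = filter-all _ (All.map (λ j<b → >⇒≢ j<b) j<bs)

-- A strictly increasing list contains `j` only once, so the filter removes exactly one entry.
length-filter-≢ : ∀ {j bs} → Increasing bs → j ∈ bs →
                  suc (length (filter (λ b → ¬? (b ≟ j)) bs)) ≡ length bs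
length-filter-≢ {j} {bs = _ ∷ bs} (j<bs ∷ _) (here refl)
  rewrite filter-reject (λ b → ¬? (b ≟ j)) {xs = bs} (λ j≢j → j≢j refl) =
  cong (suc ∘ length) (filter-≢-∉ j<bs)
length-filter-≢ {j} {b ∷ bs} (b<bs ∷ bs↗) (there j∈bs)
  rewrite filter-accept (λ b → ¬? (b ≟ j)) {xs = bs} (<⇒≢ (All.lookup b<bs j∈bs)) =
  cong suc (length-filter-≢ bs↗ j∈bs)

-- Since the indices in `js` are distinct, removing one leaves the others in the list, and each
-- deletion costs exactly one entry.
length-delete : ∀ {js bs} → AllPairs _≢_ js → Increasing bs → All (_∈ bs) js →
                length js + length (delete js bs) ≡ length bs
length-delete [] bs↗ [] = refl
length-delete {j ∷ js} {bs} (j∉js ∷ js!) bs↗ (j∈bs ∷ js⊆bs) =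
  trans (cong suc (length-delete js! (AllPairs.filter⁺ _ bs↗)
           (All.zipWith (λ (j≢i , i∈bs) → ∈-filter⁺ _ i∈bs (j≢i ∘ sym)) (j∉js , js⊆bs))))
        (length-filter-≢ bs↗ j∈bs)

-- Block lists are represented by the indices of the members that separate the
-- blocks, so that adding two blocks together is deleting one index.
module IncreasingSequence (u : ℕ → ℕ) (u-step : ∀ j → u j < u (suc j)) where

  u-mono-≤ : ∀ {i j} → i ≤ j → u i ≤ u j
  u-mono-≤ {i} i≤j = go (≤⇒≤′ i≤j)
    where
    go : ∀ {j} → i ≤′ j → u i ≤ u j
    go ≤′-refl       = ≤-refl
    go (≤′-step i≤j) = ≤-trans (go i≤j) (<⇒≤ (u-step _))

  u-mono-< : ∀ {i j} → i < j → u i < u j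
  u-mono-< {i} i<j = <-≤-trans (u-step i) (u-mono-≤ i<j)

  u-cancel-< : ∀ {i j} → u i < u j → i < j
  u-cancel-< ui<uj = ≰⇒> λ j≤i → <⇒≱ ui<uj (u-mono-≤ j≤i)

  u-cancel-≤ : ∀ {i j} → u i ≤ u j → i ≤ j
  u-cancel-≤ ui≤uj = ≮⇒≥ λ j<i → <⇒≱ (u-mono-< j<i) ui≤uj

  u-injective : ∀ {i j} → u i ≡ u j → i ≡ j
  u-injective eq = ≤-antisym (u-cancel-≤ (≤-reflexive eq)) (u-cancel-≤ (≤-reflexive (sym eq)))

  -- A `Block` records only its right end, so the left end `a` of the first block has to be supplied
  -- separately.
  spanBlocks : ℕ → List ℕ → List Block
  spanBlocks a []       = []
  spanBlocks a (b ∷ bs) = (b , u b ∸ u a) ∷ spanBlocks b bs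

  spanBlocks-sums : ∀ a bs → map proj₂ (spanBlocks a bs) ≡ differences (map u (a ∷ bs))
  spanBlocks-sums a []       = refl
  spanBlocks-sums a (b ∷ bs) = cong (u b ∸ u a ∷_) (spanBlocks-sums b bs)

  blocks-applyUpTo : ∀ f n → (∀ i → f i ≡ u (suc i) ∸ u i) →
                     blocks (applyUpTo f n) ≡ spanBlocks 0 (applyUpTo suc n)
  blocks-applyUpTo f n f≗ rewrite length-applyUpTo f n = go id f n f≗
    where
    -- The map `ι` absorbs the shift by `suc` that `applyUpTo` introduces at every recursive call.
    go : ∀ (ι f : ℕ → ℕ) n → (∀ i → f i ≡ u (ι (suc i)) ∸ u (ι i)) →
         zip (applyUpTo (ι ∘ suc) n) (applyUpTo f n) ≡ spanBlocks (ι 0) (applyUpTo (ι ∘ suc) n)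
    go ι f zero    f≗ = refl
    go ι f (suc n) f≗ =
      cong₂ _∷_ (cong (ι 1 ,_) (f≗ 0)) (go (ι ∘ suc) (f ∘ suc) n (f≗ ∘ suc))

  -- The `Any` hypothesis ensures that no final block ends at `j`: such a block has no successor to
  -- merge with, so `addTogether` would keep it while the filter would drop its index.
  addTogether-spanBlocks : ∀ j a bs → Increasing (a ∷ bs) → Any (j <_) bs →
    addTogether j (spanBlocks a bs) ≡ spanBlocks a (filter (λ b → ¬? (b ≟ j)) bs)
  addTogether-spanBlocks j a (b ∷ []) _ (here j<b)
    rewrite filter-accept (λ b → ¬? (b ≟ j)) {xs = []} (>⇒≢ j<b) = refl
  addTogether-spanBlocks j a (b ∷ b′ ∷ bs) ((a<b ∷ _) ∷ bs↗@(b<bs@(b<b′ ∷ _) ∷ _)) j<bs =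
    split (b ≟ j) (addTogether-spanBlocks j b (b′ ∷ bs) bs↗ (later j<bs))
    where
    open ≡-Reasoning
    Q? = λ i → ¬? (i ≟ j)
    merged   = (b′ , u b ∸ u a + (u b′ ∸ u b)) ∷ spanBlocks b′ bs
    separate = (b , u b ∸ u a) ∷ addTogether j (spanBlocks b (b′ ∷ bs))

    later : Any (j <_) (b ∷ b′ ∷ bs) → Any (j <_) (b′ ∷ bs)
    later (here j<b)  = here (<-trans j<b b<b′)
    later (there any) = any

    split : Dec (b ≡ j) →
            addTogether j (spanBlocks b (b′ ∷ bs)) ≡ spanBlocks b (filter Q? (b′ ∷ bs)) →
            (if does (b ≟ j) then merged else separate) ≡
            spanBlocks a (filter Q? (b ∷ b′ ∷ bs))
    split (yes refl) _ = begin
      (if does (j ≟ j) then merged else separate)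
        ≡⟨ cong (if_then merged else separate) (dec-true (j ≟ j) refl) ⟩
      merged
        -- The two adjacent spans telescope, as `u b` lies between `u a` and `u b′`.
        ≡⟨ cong (λ s → (b′ , s) ∷ spanBlocks b′ bs) (begin
             u b ∸ u a + (u b′ ∸ u b)   ≡⟨ +-comm (u b ∸ u a) _ ⟩
             u b′ ∸ u b + (u b ∸ u a)   ≡⟨ +-∸-assoc (u b′ ∸ u b) (u-mono-≤ (<⇒≤ a<b)) ⟨
             u b′ ∸ u b + u b ∸ u a     ≡⟨ cong (_∸ u a) (m∸n+n≡m (u-mono-≤ (<⇒≤ b<b′))) ⟩
             u b′ ∸ u a                 ∎) ⟩
      spanBlocks a (b′ ∷ bs)
        -- `addTogether` stops at its first match while the filter goes on; the remaining indices
        -- all exceed `j`, so the results agree.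
        ≡⟨ cong (spanBlocks a) (filter-≢-∉ b<bs) ⟨
      spanBlocks a (filter Q? (b′ ∷ bs))
        ≡⟨ cong (spanBlocks a) (filter-reject Q? {xs = b′ ∷ bs} (λ j≢j → j≢j refl)) ⟨
      spanBlocks a (filter Q? (j ∷ b′ ∷ bs)) ∎
    split (no b≢j) rest = begin
      (if does (b ≟ j) then merged else separate)
        ≡⟨ cong (if_then merged else separate) (dec-false (b ≟ j) b≢j) ⟩
      separate
        ≡⟨ cong ((b , u b ∸ u a) ∷_) rest ⟩
      spanBlocks a (b ∷ filter Q? (b′ ∷ bs))
        ≡⟨ cong (spanBlocks a) (filter-accept Q? {xs = b′ ∷ bs} b≢j) ⟨
      spanBlocks a (filter Q? (b ∷ b′ ∷ bs)) ∎

  -- The index `n` exceeds everything deleted and hence survives every round, so each addition still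
  -- finds a block to its right.
  additions-spanBlocks : ∀ {n} js a bs → Increasing (a ∷ bs) → n ∈ bs → All (_< n) js →
    foldl (λ bs j → addTogether j bs) (spanBlocks a bs) js ≡ spanBlocks a (delete js bs)
  additions-spanBlocks []       a bs _ _ _ = refl
  additions-spanBlocks (j ∷ js) a bs (a<bs ∷ bs↗) n∈bs (j<n ∷ js<n)
    rewrite addTogether-spanBlocks j a bs (a<bs ∷ bs↗) (lose n∈bs j<n) =
    additions-spanBlocks js a _ (All.filter⁺ _ a<bs ∷ AllPairs.filter⁺ _ bs↗)
      (∈-filter⁺ _ n∈bs (>⇒≢ j<n)) js<n

-- Coprimality to the primorial

p-prime : ∀ i → Prime (p (suc i))
p-prime i = proj₁ (proj₂ (proj₂ (nextPrime-spec (p i))))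

p-< : ∀ i → p i < p (suc i)
p-< i = proj₁ (proj₂ (nextPrime-spec (p i)))

p-least : ∀ i {r} → p i < r → Prime r → p (suc i) ≤ r
p-least i = proj₂ (proj₂ (proj₂ (nextPrime-spec (p i)))) _

Π-suc : ∀ k → Π (suc k) ≡ Π k * p (suc k)
Π-suc = product-applyUpTo-suc (λ i → p (suc i))

Φ-suc : ∀ k → Φ (suc k) ≡ Φ k * (p (suc k) ∸ 1)
Φ-suc = product-applyUpTo-suc (λ i → p (suc i) ∸ 1)

Π-positive : ∀ k → 1 ≤ Π k
Π-positive zero    = ≤-refl
Π-positive (suc k) = subst (1 ≤_) (sym (Π-suc k))
  (*-mono-≤ (Π-positive k) (≤-trans (s≤s z≤n) (p-< k)))

coprime-∣ˡ : ∀ {a b n} → a ∣ b → Coprime b n → Coprime a n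
coprime-∣ˡ a∣b b⊥n (d∣a , d∣n) = b⊥n (∣-trans d∣a a∣b , d∣n)

coprime-∣ʳ : ∀ {a m n} → m ∣ n → Coprime a n → Coprime a m
coprime-∣ʳ m∣n a⊥n (d∣a , d∣m) = a⊥n (d∣a , ∣-trans d∣m m∣n)

coprime-*ʳ : ∀ {a m n} → Coprime a m → Coprime a n → Coprime a (m * n)
coprime-*ʳ a⊥m a⊥n (d∣a , d∣mn) =
  a⊥n (d∣a , coprime-divisor (coprime-∣ˡ d∣a a⊥m) d∣mn)

coprime-*ˡ : ∀ {a b n} → Coprime a n → Coprime b n → Coprime (a * b) n
coprime-*ˡ a⊥n b⊥n = Coprimality.sym (coprime-*ʳ (Coprimality.sym a⊥n) (Coprimality.sym b⊥n))

coprime-+* : ∀ {m n} t → Coprime m n → Coprime (m + t * n) n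
coprime-+* {m} {n} t m⊥n {d} (d∣m+tn , d∣n) =
  m⊥n (∣m+n∣m⇒∣n (subst (d ∣_) (+-comm m (t * n)) d∣m+tn) (∣n⇒∣m*n t d∣n) , d∣n)

prime∤⇒coprime : ∀ {q m} → Prime q → ¬ (q ∣ m) → Coprime m q
prime∤⇒coprime q-prime q∤m (d∣m , d∣q) with prime⇒irreducible q-prime d∣q
... | inj₁ d≡1  = d≡1
... | inj₂ refl = contradiction d∣m q∤m

-- Induction over the factors of `Π k`: each of them is a prime smaller than the prime `r`.
largePrime-coprime-Π : ∀ k {r} → Prime r → p k < r → Coprime r (Π k)
largePrime-coprime-Π zero    r-prime _   = Coprimality.sym (1-coprimeTo _)
largePrime-coprime-Π (suc k) r-prime p<r = subst (Coprime _) (sym (Π-suc k))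
  (coprime-*ʳ (largePrime-coprime-Π k r-prime (<-trans (p-< k) p<r))
              (prime⇒coprime r-prime {{prime⇒nonZero (p-prime k)}} p<r))

-- The enumeration `p` skips no prime: by `p-least`, a prime above `p k` and at most `p (suc k)` is
-- `p (suc k)` itself.
smallPrime-∣-Π : ∀ k {r} → Prime r → r ≤ p k → r ∣ Π k
smallPrime-∣-Π zero    r-prime r≤1 =
  contradiction r≤1 (<⇒≱ (nonTrivial⇒n>1 _ {{prime⇒nonTrivial r-prime}}))
smallPrime-∣-Π (suc k) {r} r-prime r≤p with r ≤? p k
... | yes r≤pk = subst (r ∣_) (sym (Π-suc k)) (∣m⇒∣m*n _ (smallPrime-∣-Π k r-prime r≤pk))
... | no  r≰pk = subst (r ∣_) (sym (Π-suc k))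
  (subst (_∣ Π k * p (suc k)) (≤-antisym (p-least k (≰⇒> r≰pk) r-prime) r≤p) (n∣m*n (Π k)))

primeDivisor : ∀ n → 1 < n → ∃[ r ] (Prime r × r ∣ n)
primeDivisor n@(suc _) 1<n with factorise n
... | record { factors = [] ; isFactorisation = eq } = contradiction (sym eq) (<⇒≢ 1<n)
... | record { factors = r ∷ rs ; isFactorisation = eq ; factorsPrime = r-prime ∷ _ } =
  r , r-prime , subst (r ∣_) (sym eq) (m∣m*n _)

-- The increasing enumeration of the positive integers coprime to Π k

-- Index 0 gives the integer 1, so gap `j` ends at `u k j`, and adding gaps `j` and `j + 1` together
-- removes exactly `u k j`.
u : ℕ → ℕ → ℕ
u k j = suc (Γ k j)

L : ℕ → ℕ
L k = length (𝒢 k)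

module _ (k : ℕ) where

  coprimes-increasing : Increasing (coprimes k)
  coprimes-increasing = AllPairs.filter⁺ (λ m → coprime? m (Π k))
    (AllPairs.applyUpTo⁺₁ suc (Π k + 1) (λ i<j _ → s<s i<j))

  ∈-coprimes⁺ : ∀ {m} → 1 ≤ m → m ≤ Π k + 1 → Coprime m (Π k) → m ∈ coprimes k
  ∈-coprimes⁺ {suc m} _ m<Π+1 m⊥Π =
    ∈-filter⁺ (λ m → coprime? m (Π k)) (∈-applyUpTo⁺ suc m<Π+1) m⊥Π

  ∈-coprimes⁻ : ∀ {m} → m ∈ coprimes k → 1 ≤ m × m ≤ Π k + 1 × Coprime m (Π k)
  ∈-coprimes⁻ m∈
    with ∈-filter⁻ (λ m → coprime? m (Π k)) {xs = applyUpTo suc (Π k + 1)} m∈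
  ... | m∈range , m⊥Π with ∈-applyUpTo⁻ suc m∈range
  ... | i , i<Π+1 , refl = s≤s z≤n , i<Π+1 , m⊥Π

  coprimes-head : ∃[ ms ] coprimes k ≡ 1 ∷ ms
  coprimes-head = _ , trans
    (cong (λ n → filter (λ m → coprime? m (Π k)) (applyUpTo suc n)) (+-comm (Π k) 1))
    (filter-accept (λ m → coprime? m (Π k)) (1-coprimeTo (Π k)))

  𝒢-g : applyUpTo (λ i → g k (suc i)) (L k) ≡ 𝒢 k
  𝒢-g = applyUpTo-lookup (𝒢 k) (λ i → g k (suc i)) λ i →
    cong (lookup (𝒢 k)) (toℕ-injective
      (trans (toℕ-fromℕ< _) (m<n⇒m%n≡m {{length-𝒢-nonZero k}} (toℕ<n i))))

  g-periodic : ∀ i → g k (suc (L k + i)) ≡ g k (suc i)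
  g-periodic i = cong (lookup (𝒢 k)) (toℕ-injective (begin
    toℕ (((L k + i) mod L k) {{nz}}) ≡⟨ toℕ-fromℕ< _ ⟩
    ((L k + i) % L k) {{nz}}         ≡⟨ cong (λ n → (n % L k) {{nz}}) (+-comm (L k) i) ⟩
    ((i + L k) % L k) {{nz}}         ≡⟨ [m+n]%n≡m%n i (L k) {{nz}} ⟩
    (i % L k) {{nz}}                 ≡⟨ toℕ-fromℕ< _ ⟨
    toℕ ((i mod L k) {{nz}})         ∎))
    where
    open ≡-Reasoning
    nz = length-𝒢-nonZero k

  concat-𝒢 : ∀ q → concat (replicate q (𝒢 k)) ≡ applyUpTo (λ i → g k (suc i)) (q * L k)
  concat-𝒢 q = trans (cong (concat ∘ replicate q) (sym 𝒢-g))
    (concat-replicate-periodic (λ i → g k (suc i)) (L k) q g-periodic)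

  g-positive : ∀ i → 0 < g k (suc i)
  g-positive i = All.lookup (differences-positive coprimes-increasing) (∈-lookup _)

  u-suc : ∀ j → u k (suc j) ≡ u k j + g k (suc j)
  u-suc j = cong suc (sum-applyUpTo-suc (λ i → g k (suc i)) j)

  u-step : ∀ j → u k j < u k (suc j)
  u-step j = subst (u k j <_) (sym (u-suc j)) (m<m+n (u k j) (g-positive j))

  open IncreasingSequence (u k) u-step public

  -- One cycle of `L k` gaps has `L k + 1` endpoints, recovered from the gaps by telescoping from 1.
  coprimes-u : applyUpTo (u k) (suc (L k)) ≡ coprimes k
  coprimes-u = let ms , eq = coprimes-head in trans
    (partialSums-differences (λ i → g k (suc i)) (L k) (subst Increasing eq coprimes-increasing)
      (trans 𝒢-g (cong differences eq)))
    (sym eq)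

  u-index-upTo-L : ∀ {m} → 1 ≤ m → m ≤ Π k + 1 → Coprime m (Π k) → ∃[ j ] (j ≤ L k × u k j ≡ m)
  u-index-upTo-L 1≤m m≤ m⊥Π =
    let j , j<1+L , m≡uj = ∈-applyUpTo⁻ (u k)
          (subst (_ ∈_) (sym coprimes-u) (∈-coprimes⁺ 1≤m m≤ m⊥Π))
    in j , s≤s⁻¹ j<1+L , sym m≡uj

  u-upTo-L : ∀ {j} → j ≤ L k → u k j ≤ Π k + 1 × Coprime (u k j) (Π k)
  u-upTo-L {j} j≤L = proj₂ (∈-coprimes⁻ (subst (u k j ∈_) coprimes-u (∈-applyUpTo⁺ (u k) (s≤s j≤L))))

  -- The integer `Π k + 1` is coprime to `Π k` and closes the interval, so it sits at the last index
  -- of the cycle.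
  u-L : u k (L k) ≡ 1 + Π k
  u-L =
    let j , j≤L , uj≡ = u-index-upTo-L (m≤n+m 1 (Π k)) ≤-refl
          (coprime-+ {n = Π k} (1-coprimeTo (Π k)))
    in trans (≤-antisym (proj₁ (u-upTo-L ≤-refl)) (subst (_≤ u k (L k)) uj≡ (u-mono-≤ j≤L)))
             (+-comm (Π k) 1)

  u-periodic : ∀ j → u k (L k + j) ≡ u k j + Π k
  u-periodic zero    = trans (cong (u k) (+-identityʳ (L k))) u-L
  u-periodic (suc j) = begin
    u k (L k + suc j)                        ≡⟨ cong (u k) (+-suc (L k) j) ⟩
    u k (suc (L k + j))                      ≡⟨ u-suc (L k + j) ⟩
    u k (L k + j) + g k (suc (L k + j))      ≡⟨ cong₂ _+_ (u-periodic j) (g-periodic j) ⟩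
    u k j + Π k + g k (suc j)                ≡⟨ +-assoc (u k j) _ _ ⟩
    u k j + (Π k + g k (suc j))              ≡⟨ cong (u k j +_) (+-comm (Π k) _) ⟩
    u k j + (g k (suc j) + Π k)              ≡⟨ +-assoc (u k j) _ _ ⟨
    u k j + g k (suc j) + Π k                ≡⟨ cong (_+ Π k) (u-suc j) ⟨
    u k (suc j) + Π k                        ∎
    where open ≡-Reasoning

  u-periodic-* : ∀ t j → u k (t * L k + j) ≡ u k j + t * Π k
  u-periodic-* zero    j = sym (+-identityʳ (u k j))
  u-periodic-* (suc t) j = begin
    u k (L k + t * L k + j)     ≡⟨ cong (u k) (+-assoc (L k) _ j) ⟩
    u k (L k + (t * L k + j))   ≡⟨ u-periodic (t * L k + j) ⟩
    u k (t * L k + j) + Π k     ≡⟨ cong (_+ Π k) (u-periodic-* t j) ⟩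
    u k j + t * Π k + Π k       ≡⟨ +-assoc (u k j) _ _ ⟩
    u k j + (t * Π k + Π k)     ≡⟨ cong (u k j +_) (+-comm (t * Π k) (Π k)) ⟩
    u k j + suc t * Π k         ∎
    where open ≡-Reasoning

  -- Reducing `j` modulo `L k` changes `u k j` by a multiple of `Π k`, which leaves coprimality to
  -- `Π k` intact.
  u-coprime : ∀ j → Coprime (u k j) (Π k)
  u-coprime j = subst (λ m → Coprime m (Π k))
    (trans (sym (u-periodic-* t r)) (cong (u k) (sym j≡)))
    (coprime-+* t (proj₂ (u-upTo-L (<⇒≤ (m%n<n j (L k) {{nz}})))))
    where
    nz = length-𝒢-nonZero k
    r = (j % L k) {{nz}}
    t = (j / L k) {{nz}}
    j≡ : j ≡ t * L k + r
    j≡ = trans (m≡m%n+[m/n]*n j (L k) {{nz}}) (+-comm r _)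

  u-index : ∀ {m} → 1 ≤ m → Coprime m (Π k) → ∃[ j ] u k j ≡ m
  u-index {suc m} _ m⊥Π =
    let j , _ , uj≡ = u-index-upTo-L (s≤s z≤n) (subst (suc r ≤_) (+-comm 1 (Π k)) (s≤s (<⇒≤ r<Π)))
                        (coprime-r (subst (λ n → Coprime (suc n) (Π k)) m≡ m⊥Π))
    in t * L k + j , trans (u-periodic-* t j) (trans (cong (_+ t * Π k) uj≡) (cong suc (sym m≡)))
    where
    nz = >-nonZero (Π-positive k)
    -- Here `m` is the predecessor of the given integer, so the representative `suc r` lies between
    -- 1 and `Π k`, inside the range of the first cycle.
    r = (m % Π k) {{nz}}
    t = (m / Π k) {{nz}}
    r<Π : r < Π k
    r<Π = m%n<n m (Π k) {{nz}}
    m≡ : m ≡ r + t * Π k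
    m≡ = m≡m%n+[m/n]*n m (Π k) {{nz}}
    coprime-r : Coprime (suc r + t * Π k) (Π k) → Coprime (suc r) (Π k)
    coprime-r ⊥Π (d∣r , d∣Π) = ⊥Π (∣m∣n⇒∣m+n d∣r (∣n⇒∣m*n t d∣Π) , d∣Π)

-- Passing from Π k to Π (suc k)

module _ (k : ℕ) where

  private
    q N : ℕ
    q = p (suc k)
    N = q * L k

    q-prime : Prime q
    q-prime = p-prime k

    1<q : 1 < q
    1<q = nonTrivial⇒n>1 q {{prime⇒nonTrivial q-prime}}

    instance
      q-nonZero : NonZero q
      q-nonZero = prime⇒nonZero q-prime

    q⊥Π : Coprime q (Π k)
    q⊥Π = largePrime-coprime-Π k q-prime (p-< k)

  -- The prime `q` is coprime to `Π k` and exceeds 1, so it occurs at index 1 or later. Conversely,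
  -- a prime divisor of `u k 1` cannot be at most `p k`, since it would then divide `Π k`; hence it
  -- is at least `q`.
  u-1 : u k 1 ≡ q
  u-1 = ≤-antisym u1≤q q≤u1
    where
    u1≤q : u k 1 ≤ q
    u1≤q = let j , uj≡q = u-index k (<⇒≤ 1<q) q⊥Π in
      subst (u k 1 ≤_) uj≡q (u-mono-≤ k (u-cancel-< k {0} {j} (subst (1 <_) (sym uj≡q) 1<q)))
    q≤u1 : q ≤ u k 1
    q≤u1 = let r , r-prime , r∣u1 = primeDivisor (u k 1) (u-step k 0) in
      ≤-trans (p-least k (≰⇒> λ r≤p → ¬prime[1]
                (subst Prime (u-coprime k 1 (r∣u1 , smallPrime-∣-Π k r-prime r≤p)) r-prime))
              r-prime)
        (∣⇒≤ r∣u1)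

  u-multiple : ∀ i → ∃[ j ] u k j ≡ q * u k i
  u-multiple i = u-index k (*-mono-≤ (<⇒≤ 1<q) (s≤s z≤n)) (coprime-*ˡ q⊥Π (u-coprime k i))

  -- Counted from 0: `multipleIndex i` is the recorded index with number `i + 1` in (R3).
  multipleIndex : ℕ → ℕ
  multipleIndex i = proj₁ (u-multiple i)

  u-multipleIndex : ∀ i → u k (multipleIndex i) ≡ q * u k i
  u-multipleIndex i = proj₂ (u-multiple i)

  u-N : u k N ≡ 1 + q * Π k
  u-N = trans (cong (u k) (sym (+-identityʳ N))) (u-periodic-* k q 0)

  u-N-Π : u k N ≡ Π (suc k) + 1
  u-N-Π = trans u-N (trans (cong suc (trans (*-comm q (Π k)) (sym (Π-suc k)))) (+-comm 1 _))

  multipleIndex-positive : ∀ i → 0 < multipleIndex i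
  multipleIndex-positive i = u-cancel-< k (subst (1 <_) (sym (u-multipleIndex i))
    (*-mono-≤ 1<q (s≤s (z≤n {Γ k i}))))

  -- For `i < L k` the value `u k i` is below `u k (L k) = 1 + Π k`, so its multiple is at most
  -- `q * Π k`, one less than `u k N`.
  multipleIndex-<-N : ∀ {i} → i < L k → multipleIndex i < N
  multipleIndex-<-N {i} i<L = u-cancel-< k (subst₂ _<_ (sym (u-multipleIndex i)) (sym u-N)
    (s≤s (*-monoʳ-≤ q (s≤s⁻¹ (subst (u k i <_) (u-L k) (u-mono-< k i<L))))))

  multipleIndex-mono : ∀ {i j} → i < j → multipleIndex i < multipleIndex j
  multipleIndex-mono {i} {j} i<j = u-cancel-< k
    (subst₂ _<_ (sym (u-multipleIndex i)) (sym (u-multipleIndex j)) (*-monoʳ-< q (u-mono-< k i<j)))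

  multipleIndices : List ℕ
  multipleIndices = applyUpTo multipleIndex (L k)

  -- The cofactor of `q` divides `u k j`, hence is coprime to `Π k` and equals some `u k i`.
  q∣u⇒multiple : ∀ {j} → j ≤ N → q ∣ u k j → j ∈ multipleIndices
  q∣u⇒multiple {j} j≤N (divides (suc t) uj≡tq) =
    let uj≡qt = trans uj≡tq (*-comm (suc t) q)
        i , ui≡t = u-index k (s≤s z≤n) (coprime-∣ˡ (divides q uj≡qt) (u-coprime k j))
        uj≡qui = trans uj≡qt (cong (q *_) (sym ui≡t))
    in subst (_∈ multipleIndices) (u-injective k {multipleIndex i} {j} (trans (u-multipleIndex i) (sym uj≡qui)))
         (∈-applyUpTo⁺ multipleIndex (i<L i uj≡qui))
    where
    -- From `1 < q`, even the last endpoint `1 + q * Π k` is below `q * (1 + Π k)`, the multiple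
    -- that belongs to index `L k`.
    i<L : ∀ i → u k j ≡ q * u k i → i < L k
    i<L i uj≡qui = u-cancel-< k {i} {L k} (subst (u k i <_) (sym (u-L k)) (*-cancelˡ-< q _ _ (begin-strict
      q * u k i       ≡⟨ uj≡qui ⟨
      u k j           ≤⟨ u-mono-≤ k j≤N ⟩
      u k N           ≡⟨ u-N ⟩
      1 + q * Π k     <⟨ +-monoˡ-< (q * Π k) 1<q ⟩
      q + q * Π k     ≡⟨ *-suc q (Π k) ⟨
      q * suc (Π k)   ∎)))
      where open ≤-Reasoning

  multiple⇒q∣u : ∀ {j} → j ∈ multipleIndices → q ∣ u k j
  multiple⇒q∣u j∈ =
    let i , _ , j≡ = ∈-applyUpTo⁻ multipleIndex j∈
    in divides (u k i) (trans (trans (cong (u k) j≡) (u-multipleIndex i)) (*-comm q _))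

  -- These are right ends of blocks; the left end 0 of the first block is prepended wherever the
  -- underlying integers are meant.
  survivors : List ℕ
  survivors = delete multipleIndices (applyUpTo suc N)

  private
    range-increasing : Increasing (0 ∷ applyUpTo suc N)
    range-increasing = AllPairs.applyUpTo⁺₁ id (suc N) (λ i<j _ → i<j)

    ∈-range : ∀ {j} → 0 < j → j ≤ N → j ∈ applyUpTo suc N
    ∈-range {suc j} _ j<N = ∈-applyUpTo⁺ suc j<N

    survivors-increasing : Increasing (0 ∷ survivors)
    survivors-increasing =
      All.tabulate (λ j∈ → All.lookup (AllPairs.head range-increasing)
                             (proj₁ (∈-delete⁻ multipleIndices j∈)))
      ∷ delete-increasing multipleIndices (AllPairs.tail range-increasing)

    0∉multipleIndices : 0 ∉ multipleIndices
    0∉multipleIndices 0∈ =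
      let i , _ , 0≡ = ∈-applyUpTo⁻ multipleIndex 0∈ in <⇒≢ (multipleIndex-positive i) 0≡

    ∈-range⁻ : ∀ {j} → j ∈ applyUpTo suc N → j ≤ N
    ∈-range⁻ j∈ = let i , i<N , j≡ = ∈-applyUpTo⁻ suc j∈ in subst (_≤ N) (sym j≡) i<N

    ∈-survivors⁻ : ∀ {j} → j ∈ 0 ∷ survivors → j ≤ N × j ∉ multipleIndices
    ∈-survivors⁻ (here refl) = z≤n , 0∉multipleIndices
    ∈-survivors⁻ (there j∈)  =
      let j∈range , j∉ = ∈-delete⁻ multipleIndices j∈ in ∈-range⁻ j∈range , j∉

    ∈-survivors⁺ : ∀ j → j ≤ N → j ∉ multipleIndices → j ∈ 0 ∷ survivors
    ∈-survivors⁺ zero    _   _  = here refl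
    ∈-survivors⁺ (suc j) j≤N j∉ = there (∈-delete⁺ multipleIndices (∈-range z<s j≤N) j∉)

  -- Being coprime to `Π (suc k) = Π k * q` means being coprime to `Π k` and not divisible by `q`;
  -- the range matches because `u k N = Π (suc k) + 1`.
  survivors-coprimes : map (u k) (0 ∷ survivors) ≡ coprimes (suc k)
  survivors-coprimes = increasing-ext
    (AllPairs.map⁺ (AllPairs.map (u-mono-< k) survivors-increasing))
    (coprimes-increasing (suc k)) ⊆-coprimes ⊇-coprimes
    where
    ⊆-coprimes : ∀ {m} → m ∈ map (u k) (0 ∷ survivors) → m ∈ coprimes (suc k)
    ⊆-coprimes m∈ =
      let j , j∈ , m≡uj = ∈-map⁻ (u k) m∈
          j≤N , j∉ = ∈-survivors⁻ j∈
      in subst (_∈ coprimes (suc k)) (sym m≡uj)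
        (∈-coprimes⁺ (suc k) (s≤s z≤n) (subst (u k j ≤_) u-N-Π (u-mono-≤ k j≤N))
          (subst (Coprime (u k j)) (sym (Π-suc k))
            (coprime-*ʳ (u-coprime k j) (prime∤⇒coprime q-prime (j∉ ∘ q∣u⇒multiple j≤N)))))

    ⊇-coprimes : ∀ {m} → m ∈ coprimes (suc k) → m ∈ map (u k) (0 ∷ survivors)
    ⊇-coprimes {m} m∈ =
      let 1≤m , m≤ , m⊥Π′ = ∈-coprimes⁻ (suc k) m∈ in
      preimage 1≤m m≤ (subst (Coprime m) (Π-suc k) m⊥Π′)
      where
      j∈survivors : ∀ j → u k j ≡ m → m ≤ Π (suc k) + 1 → Coprime m (Π k * q) → j ∈ 0 ∷ survivors
      j∈survivors j uj≡m m≤ m⊥Πq = ∈-survivors⁺ j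
        (u-cancel-≤ k {j} {N} (subst₂ _≤_ (sym uj≡m) (sym u-N-Π) m≤))
        -- A deleted index would make `q` a common divisor of `m` and `Π k * q`, forcing `q = 1`.
        (λ j∈ → >⇒≢ 1<q (m⊥Πq (subst (q ∣_) uj≡m (multiple⇒q∣u j∈) , n∣m*n (Π k))))

      preimage : 1 ≤ m → m ≤ Π (suc k) + 1 → Coprime m (Π k * q) → m ∈ map (u k) (0 ∷ survivors)
      preimage 1≤m m≤ m⊥Πq =
        let j , uj≡m = u-index k 1≤m (coprime-∣ʳ (m∣m*n q) m⊥Πq) in
        subst (_∈ map (u k) (0 ∷ survivors)) uj≡m
          (∈-map⁺ (u k) (j∈survivors j uj≡m m≤ m⊥Πq))

  private
    multiples-in-range : ∀ {i} → i < L k → multipleIndex i ∈ applyUpTo suc N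
    multiples-in-range i<L = ∈-range (multipleIndex-positive _) (<⇒≤ (multipleIndex-<-N i<L))

  -- The `q * L k` gaps lose one for each of the `L k` deletions.
  L-suc : L (suc k) ≡ L k * (q ∸ 1)
  L-suc = begin
    L (suc k)                             ≡⟨ cong (length ∘ differences) survivors-coprimes ⟨
    length (differences (map (u k) (0 ∷ survivors)))
      ≡⟨ length-differences (u k 0) (map (u k) survivors) ⟩
    length (map (u k) survivors)          ≡⟨ length-map (u k) survivors ⟩
    length survivors                      ≡⟨ m+n∸m≡n (L k) (length survivors) ⟨
    L k + length survivors ∸ L k          ≡⟨ cong (_∸ L k) count ⟩
    q * L k ∸ L k                         ≡⟨ cong₂ _∸_ (*-comm q (L k)) (sym (*-identityʳ (L k))) ⟩
    L k * q ∸ L k * 1                     ≡⟨ *-distribˡ-∸ (L k) q 1 ⟨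
    L k * (q ∸ 1)                         ∎
    where
    open ≡-Reasoning
    count : L k + length survivors ≡ N
    count = begin
      L k + length survivors
        ≡⟨ cong (_+ length survivors) (length-applyUpTo multipleIndex (L k)) ⟨
      length multipleIndices + length survivors
        ≡⟨ length-delete
             (AllPairs.applyUpTo⁺₁ multipleIndex (L k) (λ i<j _ → <⇒≢ (multipleIndex-mono i<j)))
             (AllPairs.tail range-increasing)
             (All.applyUpTo⁺₁ multipleIndex (L k) multiples-in-range) ⟩
      length (applyUpTo suc N)
        ≡⟨ length-applyUpTo suc N ⟩
      N ∎

  additions-𝒢 : performAdditions multipleIndices (concat (replicate q (𝒢 k))) ≡ 𝒢 (suc k)
  additions-𝒢 = begin
    performAdditions multipleIndices (concat (replicate q (𝒢 k)))
      ≡⟨ cong (performAdditions multipleIndices) (concat-𝒢 k q) ⟩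
    map proj₂ (additions (blocks (applyUpTo (λ i → g k (suc i)) N)))
      ≡⟨ cong (map proj₂ ∘ additions) (blocks-applyUpTo k _ N gap) ⟩
    map proj₂ (additions (spanBlocks k 0 (applyUpTo suc N)))
      ≡⟨ cong (map proj₂) (additions-spanBlocks k multipleIndices 0 _ range-increasing
           -- The surviving index required by `additions-spanBlocks` is `N`, the right end of the
           -- whole concatenation.
           (∈-range (≤-<-trans z≤n (multipleIndex-<-N 0<L)) ≤-refl)
           (All.applyUpTo⁺₁ multipleIndex (L k) multipleIndex-<-N)) ⟩
    map proj₂ (spanBlocks k 0 survivors)
      ≡⟨ spanBlocks-sums k 0 survivors ⟩
    differences (map (u k) (0 ∷ survivors))
      ≡⟨ cong differences survivors-coprimes ⟩
    𝒢 (suc k) ∎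
    where
    open ≡-Reasoning
    additions : List Block → List Block
    additions bs = foldl (λ bs j → addTogether j bs) bs multipleIndices
    gap : ∀ i → g k (suc i) ≡ u k (suc i) ∸ u k i
    gap i = sym (trans (cong (_∸ u k i) (u-suc k i)) (m+n∸m≡n (u k i) _))
    0<L : 0 < L k
    0<L = >-nonZero⁻¹ (L k) {{length-𝒢-nonZero k}}

-- Length of the cycle and the recorded indices.

L≡Φ : ∀ k → L k ≡ Φ k
-- For the empty product the integers are 1 and 2, with a single gap, and `Φ 0` is 1.
L≡Φ zero    = refl
L≡Φ (suc k) = trans (L-suc k) (trans (cong (_* (p (suc k) ∸ 1)) (L≡Φ k)) (sym (Φ-suc k)))

additionIndices : ∀ k → IsAdditionIndices k (λ n → multipleIndex k (n ∸ 1))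
additionIndices k = record
  { first   = u-injective k (trans (u-multipleIndex k 0)
                (trans (*-identityʳ (p (suc k))) (sym (u-1 k))))
  ; next    = λ { (suc n) _ _ → spaced n }
  -- The spacing equation determines `Γ k j`, and strict growth of `u k` then determines `j`.
  ; unique  = λ { (suc n) _ _ j eq → u-injective k (cong suc (trans eq (sym (spaced n)))) }
  ; inRange = λ { (suc n) _ n<Φ → multipleIndex-positive k n ,
                  subst (λ ℓ → multipleIndex k n < p (suc k) * ℓ) (L≡Φ k)
                    (multipleIndex-<-N k (subst (n <_) (sym (L≡Φ k)) n<Φ)) }
  }
  where
  spaced : ∀ n → Spaced k (suc n) (multipleIndex k n) (multipleIndex k (suc n))
  -- The equation is proved for `u k`, where multiplication by `p (suc k)` distributes over one step
  -- of the sequence; cancelling the 1 gives it for `Γ k`.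
  spaced n = suc-injective (begin
    u k (multipleIndex k (suc n))                        ≡⟨ u-multipleIndex k (suc n) ⟩
    p (suc k) * u k (suc n)                              ≡⟨ cong (p (suc k) *_) (u-suc k n) ⟩
    p (suc k) * (u k n + g k (suc n))                    ≡⟨ *-distribˡ-+ (p (suc k)) (u k n) _ ⟩
    p (suc k) * u k n + p (suc k) * g k (suc n)
      ≡⟨ cong (_+ p (suc k) * g k (suc n)) (u-multipleIndex k n) ⟨
    u k (multipleIndex k n) + p (suc k) * g k (suc n)    ∎)
    where open ≡-Reasoning

lemma3p1 : ∀ (k : ℕ) → 1 ≤ k →
    (p (suc k) ≡ g k 1 + 1)
    × (concat (replicate (p (suc k)) (𝒢 k))
         ≡ applyUpTo (λ i → g k (suc i)) (p (suc k) * Φ k))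
    × (∃[ ĩ ] (IsAdditionIndices k ĩ
         × (performAdditions (applyUpTo (λ n → ĩ (suc n)) (Φ k))
              (concat (replicate (p (suc k)) (𝒢 k)))
              ≡ 𝒢 (suc k))))
lemma3p1 k _ =
    trans (sym (u-1 k)) (trans (u-suc k 0) (+-comm 1 (g k 1)))
  , trans (concat-𝒢 k (p (suc k)))
      (cong (λ ℓ → applyUpTo (λ i → g k (suc i)) (p (suc k) * ℓ)) (L≡Φ k))
  , (λ n → multipleIndex k (n ∸ 1))
  , additionIndices k
  , trans (cong (λ ℓ → performAdditions (applyUpTo (multipleIndex k) ℓ)
                         (concat (replicate (p (suc k)) (𝒢 k)))) (sym (L≡Φ k)))
      (additions-𝒢 k)
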